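{- Let $G=(V,E)$ be a loopless graph (multiple edges allowed), viewed as a hypergraph in which every hyperedge has two elements, and fix a ribbon structure, base node and base edge on $\mathrm{Bip}\,G$. Let $T$ be a $V$-cut Jaeger tree of $\mathrm{Bip}\,G$ and let $S$ be the set of edges of $T$ that are internally semi-passive with respect to the violet $T$-order of the edges of $\mathrm{Bip}\,G$. Then $S$ is a perfect matching between the set of internally inactive elements of $V$ for $\mathbf f_V(T)$ (with respect to the violet $T$-order on $V$) and the set of internally inactive elements of $E$ for $\mathbf f_E(T)$ (with respect to the violet $T$-order on $E$): every edge of $S$ joins two such inactive nodes, and every such inactive node is incident to exactly one edge of $S$.
   Context: $\mathrm{Bip}\,G$ is the bipartite graph with color classes $V$ (violet) and $E$ (emerald), each $e\in E$ joined to its two endpoints. A ribbon structure assigns to each node $x$ a cyclic permutation of its incident edges; $xy^+$ is the edge following $xy$ at $x$. Base node $b_0$, incident base edge $b_0b_1$. Tour of a spanning tree $T$ of $\mathrm{Bip}\,G$: pairs (current node, current edge) starting with $(b_0,b_0b_1)$; from $(x,xy)$ go to $(x,xy^+)$ if $xy\notin T$, to $(y,yx^+)$ if $xy\in T$; stop right before $(b_0,b_0b_1)$ recurs. Each edge $xy$ appears exactly twice; a non-edge $xy$ is cut at $x$ if $(x,xy)$ comes first. $T$ is a $V$-cut Jaeger tree if every non-edge of $T$ is cut at its violet endpoint. Violet $T$-order on edges: $ev<_{T,V}e'v'$ ($v,v'\in V$) iff $(v,ev)$ precedes $(v',e'v')$ in the tour. Violet $T$-order on $E$ (resp. $V$):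 $x_1<x_2$ iff some edge incident to $x_1$ precedes in the violet $T$-order every edge incident to $x_2$. For $\varepsilon\in T$, $C^*(T,\varepsilon)$ is the set of edges joining the two components of $T-\varepsilon$. Given a linear order on edges, $\varepsilon\in T$ is internally semi-passive if the smallest edge of $C^*(T,\varepsilon)$ has, in each component of $T-\varepsilon$, an endpoint of color different from the endpoint of $\varepsilon$ there. A hypertree on $E$ is $\mathbf f:E\to\mathbb Z_{\ge0}$ such that some spanning tree of $\mathrm{Bip}\,G$ has degree $\mathbf f(e)+1$ at each $e\in E$; similarly on $V$; $\mathbf f_E(T)(e)=d_T(e)-1$, $\mathbf f_V(T)(v)=d_T(v)-1$. Given a linear order on $X\in\{E,V\}$ and a hypertree $\mathbf f$ on $X$, $x\in X$ is internally inactive if there is $x'<x$ such that decreasing $\mathbf f$ by $1$ at $x$ and increasing by $1$ at $x'$ yields a hypertree on $X$. -}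

module Defs where

open import Data.Nat using (ℕ; zero; suc; _+_; _∸_; _≤_)
open import Data.Fin using (Fin; zero; suc)
open import Data.Fin.Properties using (_≟_)
open import Data.Bool using (Bool; true; false; if_then_else_; _∧_)
open import Data.Product using (Σ; _×_; _,_; ∃)
open import Data.Sum using (_⊎_; inj₁; inj₂)
open import Relation.Nullary using (¬_; yes; no)
open import Relation.Nullary.Decidable using (⌊_⌋)
open import Relation.Binary.PropositionalEquality using (_≡_; _≢_)
open import Function.Definitions using (Injective)

record Graph : Set where
  field
    n m       : ℕ
    ends      : Fin m → Fin 2 → Fin n
    loopless  : ∀ e → ends e zero ≢ ends e (suc zero)

iter : {A : Set} → (A → A) → ℕ → A → A
iter f zero    a = a
iter f (suc k) a = f (iter f k a)

countFin : (k : ℕ) → (Fin k → Bool) → ℕ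
countFin zero    p = 0
countFin (suc k) p = (if p zero then 1 else 0) + countFin k (λ i → p (suc i))

sumFin : (k : ℕ) → (Fin k → ℕ) → ℕ
sumFin zero    f = 0
sumFin (suc k) f = f zero + sumFin k (λ i → f (suc i))

flip2 : Fin 2 → Fin 2
flip2 zero       = suc zero
flip2 (suc zero) = zero

data Colour : Set where
  violet emerald : Colour

opp : Colour → Colour
opp violet  = emerald
opp emerald = violet

module _ (G : Graph) where
  open Graph G

  Node : Set
  Node = Fin n ⊎ Fin m

  BipEdge : Set
  BipEdge = Fin m × Fin 2

  vend : BipEdge → Fin n
  vend (e , i) = ends e i

  eend : BipEdge → Fin m
  eend (e , i) = e

  endpt : BipEdge → Colour → Node
  endpt ε violet  = inj₁ (vend ε)
  endpt ε emerald = inj₂ (eend ε)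

  -- Ribbon structure.  At an emerald node (degree 2) the unique cyclic
  -- permutation is the swap; at violet nodes it is given by  rotV , a
  -- permutation of BipEdge preserving the violet endpoint and cyclic on
  -- the set of edges at each violet node.

  record Ribbon : Set where
    field
      rotV       : BipEdge → BipEdge
      rotV-node  : ∀ ε → vend (rotV ε) ≡ vend ε
      rotV-inj   : Injective _≡_ _≡_ rotV
      rotV-cyc   : ∀ ε ε' → vend ε ≡ vend ε' → Σ ℕ λ k → iter rotV k ε ≡ ε'

  -- Subgraphs of Bip G (spanning, given by edge sets)
  Sub : Set
  Sub = BipEdge → Bool

  data Reach (P : BipEdge → Set) (x : Node) : Node → Set where
    here : Reach P x x
    step : ∀ {δ} c → P δ → Reach P x (endpt δ c) → Reach P x (endpt δ (opp c))

  InT : Sub → BipEdge → Set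
  InT T δ = T δ ≡ true

  InTminus : Sub → BipEdge → BipEdge → Set
  InTminus T ε δ = (T δ ≡ true) × (δ ≢ ε)

  IsSpanningTree : Sub → Set
  IsSpanningTree T =
    (∀ x y → Reach (InT T) x y) ×
    (∀ ε → T ε ≡ true → ¬ Reach (InTminus T ε) (endpt ε violet) (endpt ε emerald))

  degE : Sub → Fin m → ℕ
  degE T e = countFin 2 (λ i → T (e , i))

  degV : Sub → Fin n → ℕ
  degV T v = sumFin m (λ e → countFin 2 (λ i → T (e , i) ∧ ⌊ ends e i ≟ v ⌋))

  IsHypertreeE : (Fin m → ℕ) → Set
  IsHypertreeE f = Σ Sub λ T' → IsSpanningTree T' × (∀ e → degE T' e ≡ suc (f e))

  IsHypertreeV : (Fin n → ℕ) → Set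
  IsHypertreeV f = Σ Sub λ T' → IsSpanningTree T' × (∀ v → degV T' v ≡ suc (f v))

  fE : Sub → Fin m → ℕ
  fE T e = degE T e ∸ 1

  fV : Sub → Fin n → ℕ
  fV T v = degV T v ∸ 1

  -- Tours.  A state (δ , c) means: current node = endpoint of δ of
  -- colour c, current edge = δ.

  State : Set
  State = BipEdge × Colour

  module _ (R : Ribbon) where
    open Ribbon R

    rot : State → State
    rot (ε , violet)        = (rotV ε , violet)
    rot ((e , i) , emerald) = ((e , flip2 i) , emerald)

    tourStep : Sub → State → State
    tourStep T (ε , c) = if T ε then rot (ε , opp c) else rot (ε , c)

    Precedes : Sub → State → State → State → Set
    Precedes T base s s' =
      Σ ℕ λ i → (iter (tourStep T) i base ≡ s) ×
                (∀ j → j ≤ i → iter (tourStep T) j base ≢ s')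

    IsVCutJaeger : Sub → State → Set
    IsVCutJaeger T base =
      IsSpanningTree T ×
      (∀ ε → T ε ≡ false → Precedes T base (ε , violet) (ε , emerald))

    _<edge[_,_]_ : BipEdge → Sub → State → BipEdge → Set
    ε <edge[ T , base ] ε' = Precedes T base (ε , violet) (ε' , violet)

    _<E[_,_]_ : Fin m → Sub → State → Fin m → Set
    e₁ <E[ T , base ] e₂ =
      Σ (Fin 2) λ i → ∀ i' → (e₁ , i) <edge[ T , base ] (e₂ , i')

    _<V[_,_]_ : Fin n → Sub → State → Fin n → Set
    v₁ <V[ T , base ] v₂ =
      Σ BipEdge λ ε → (vend ε ≡ v₁) ×
        (∀ ε' → vend ε' ≡ v₂ → ε <edge[ T , base ] ε')

    InCut : Sub → BipEdge → BipEdge → Set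
    InCut T ε δ =
      (Reach (InTminus T ε) (endpt ε violet) (endpt δ violet) ×
       Reach (InTminus T ε) (endpt ε emerald) (endpt δ emerald)) ⊎
      (Reach (InTminus T ε) (endpt ε violet) (endpt δ emerald) ×
       Reach (InTminus T ε) (endpt ε emerald) (endpt δ violet))

    SemiPassive : Sub → State → BipEdge → Set
    SemiPassive T base ε =
      (T ε ≡ true) ×
      Σ BipEdge λ δ →
        InCut T ε δ ×
        (∀ δ' → InCut T ε δ' → δ' ≢ δ → δ <edge[ T , base ] δ') ×
        (∀ c c' → Reach (InTminus T ε) (endpt ε c) (endpt δ c') → c ≢ c')

shift : {k : ℕ} → (Fin k → ℕ) → Fin k → Fin k → Fin k → ℕ
shift f x x' y with y ≟ x
... | yes _ = f y ∸ 1
... | no _ with y ≟ x'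
...   | yes _ = suc (f y)
...   | no _  = f y

InternallyInactive : {k : ℕ} → (Fin k → Fin k → Set) → ((Fin k → ℕ) → Set) →
                     (Fin k → ℕ) → Fin k → Set
InternallyInactive _<_ H f x =
  Σ _ λ x' → (x' < x) × (1 ≤ f x) × H (shift f x x')

{-# OPTIONS --safe #-}
-- Removing a tree edge ε cuts T into a violet side (containing its violet end) and an emerald
-- side.  The tour leaves a side only by crossing ε, so by V-cutness ε is semi-passive exactly
-- when the base node is on the emerald side and some non-edge δ has its violet end on the
-- emerald side and its emerald end on the violet side.  Then ε is the edge at its violet end
-- towards the base node, which gives uniqueness, and T − ε + δ shows that both ends of ε are
-- inactive.  Conversely, if v is inactive, the edge ε at v towards the base node has such a δ:
-- otherwise a spanning tree has at least as many edges at the violet nodes behind ε as T does,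
-- and no degree can move out of there.  If e is inactive because of e', both edges at e are
-- in T, and for one of them, ε, the base node is on the emerald side and the tour does not
-- start at (e, ε); then e' has an end on each side of ε, and its non-edge is δ.
module Submission where

open import Defs
open import Data.Bool using (Bool; true; false; if_then_else_; _∧_)
import Data.Bool.Properties as Bool
open import Data.Empty using (⊥-elim)
open import Data.Fin using (Fin; zero; suc)
open import Data.Fin.Properties using (_≟_; any?)
import Data.Fin.Properties as Fin
open import Data.Nat using (ℕ; zero; suc; _+_; _∸_; _≤_; _<_; z≤n; s≤s; _≤?_)
open import Data.Nat.Properties
  using (≤-refl; ≤-trans; ≤-reflexive; <⇒≤; <-irrefl; m≤n⇒m<n∨m≡n;
         +-assoc; +-comm; +-identityʳ; +-mono-≤; +-mono-<-≤; +-mono-≤-<;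
         +-commutativeSemigroup; suc-injective; ≰⇒>; ≤-antisym; n≤1+n; ≤∧≢⇒<)
open import Algebra.Properties.CommutativeSemigroup +-commutativeSemigroup
  using (interchange; x∙yz≈y∙xz)
open import Data.Product using (Σ; _×_; _,_; proj₁; proj₂)
open import Data.Product.Properties using (≡-dec)
open import Data.Sum using (_⊎_; inj₁; inj₂)
import Data.Sum.Properties as Sum
open import Function using (_∘_; case_of_)
open import Relation.Nullary using (¬_; Dec; yes; no)
open import Relation.Nullary.Decidable using (⌊_⌋; _×-dec_)
open import Relation.Binary.PropositionalEquality
  using (_≡_; _≢_; refl; sym; trans; cong; cong₂; subst; module ≡-Reasoning)

-- Finite sums

ι : Bool → ℕ
ι b = if b then 1 else 0

sumFin-cong : ∀ k {f g : Fin k → ℕ} → (∀ i → f i ≡ g i) → sumFin k f ≡ sumFin k g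
sumFin-cong zero    f≗g = refl
sumFin-cong (suc k) f≗g = cong₂ _+_ (f≗g zero) (sumFin-cong k (f≗g ∘ suc))

sumFin-zero : ∀ k → sumFin k (λ _ → 0) ≡ 0
sumFin-zero zero    = refl
sumFin-zero (suc k) = sumFin-zero k

sumFin-+ : ∀ k (f g : Fin k → ℕ) →
  sumFin k (λ i → f i + g i) ≡ sumFin k f + sumFin k g
sumFin-+ zero    f g = refl
sumFin-+ (suc k) f g = trans (cong (f zero + g zero +_) (sumFin-+ k (f ∘ suc) (g ∘ suc)))
                             (interchange (f zero) (g zero) _ _)

sumFin-comm : ∀ k l (f : Fin k → Fin l → ℕ) →
  sumFin k (λ i → sumFin l (f i)) ≡ sumFin l (λ j → sumFin k (λ i → f i j))
sumFin-comm zero    l f = sym (sumFin-zero l)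
sumFin-comm (suc k) l f = trans (cong (sumFin l (f zero) +_) (sumFin-comm k l (f ∘ suc)))
                                (sym (sumFin-+ l (f zero) _))

sumFin-if : ∀ k b (f : Fin k → ℕ) →
  (if b then sumFin k f else 0) ≡ sumFin k (λ i → if b then f i else 0)
sumFin-if k true  f = refl
sumFin-if k false f = sym (sumFin-zero k)

sumFin-point : ∀ k {f g : Fin k → ℕ} i {d} → (∀ j → j ≢ i → f j ≡ g j) →
  f i ≡ d + g i → sumFin k f ≡ d + sumFin k g
sumFin-point (suc k) {f} {g} zero {d} off at =
  trans (cong₂ _+_ at (sumFin-cong k λ j → off (suc j) λ ())) (+-assoc d (g zero) _)
sumFin-point (suc k) {f} {g} (suc i) {d} off at =
  trans (cong₂ _+_ (off zero λ ())
                   (sumFin-point k i (λ j j≢i → off (suc j) (j≢i ∘ Fin.suc-injective)) at))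
        (x∙yz≈y∙xz (g zero) d _)

sumFin-mono-≤ : ∀ k {f g : Fin k → ℕ} → (∀ i → f i ≤ g i) → sumFin k f ≤ sumFin k g
sumFin-mono-≤ zero    f≤g = z≤n
sumFin-mono-≤ (suc k) f≤g = +-mono-≤ (f≤g zero) (sumFin-mono-≤ k (f≤g ∘ suc))

sumFin-mono-< : ∀ k {f g : Fin k → ℕ} → (∀ i → f i ≤ g i) → ∀ i → f i < g i →
  sumFin k f < sumFin k g
sumFin-mono-< (suc k) f≤g zero    lt = +-mono-<-≤ lt (sumFin-mono-≤ k (f≤g ∘ suc))
sumFin-mono-< (suc k) f≤g (suc i) lt =
  +-mono-≤-< (f≤g zero) (sumFin-mono-< k (f≤g ∘ suc) i lt)

sumFin-pos : ∀ k (f : Fin k → ℕ) → 0 < sumFin k f → Σ (Fin k) λ i → 0 < f i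
sumFin-pos (suc k) f pos with f zero in eq
... | suc _ = zero , subst (0 <_) (sym eq) (s≤s z≤n)
... | zero  with i , p ← sumFin-pos k (f ∘ suc) pos = suc i , p

-- Least witnesses, and the types with two elements.

least : {P : ℕ → Set} → (∀ i → Dec (P i)) → ∀ k →
  (Σ ℕ λ j → j ≤ k × P j × (∀ i → i < j → ¬ P i)) ⊎ (∀ j → j ≤ k → ¬ P j)
least P? zero with P? zero
... | yes p = inj₁ (zero , z≤n , p , λ _ ())
... | no ¬p = inj₂ λ { zero _ → ¬p }
least P? (suc k) with least P? k
... | inj₁ (j , j≤k , p , min) = inj₁ (j , ≤-trans j≤k (n≤1+n k) , p , min)
... | inj₂ none with P? (suc k)
...   | yes p = inj₁ (suc k , ≤-refl , p , λ { i (s≤s i≤k) → none i i≤k })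
...   | no ¬p = inj₂ λ j j≤ → case m≤n⇒m<n∨m≡n j≤ of λ
        { (inj₁ (s≤s j≤k)) → none j j≤k ; (inj₂ refl) → ¬p }

opp-opp : ∀ c → opp (opp c) ≡ c
opp-opp violet  = refl
opp-opp emerald = refl

same-or-opp : ∀ c d → d ≡ c ⊎ d ≡ opp c
same-or-opp violet  violet  = inj₁ refl
same-or-opp violet  emerald = inj₂ refl
same-or-opp emerald violet  = inj₂ refl
same-or-opp emerald emerald = inj₁ refl

_≟ᶜ_ : (c d : Colour) → Dec (c ≡ d)
violet  ≟ᶜ violet  = yes refl
violet  ≟ᶜ emerald = no λ ()
emerald ≟ᶜ violet  = no λ ()
emerald ≟ᶜ emerald = yes refl

flip2-≢ : ∀ i → flip2 i ≢ i
flip2-≢ zero       ()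
flip2-≢ (suc zero) ()

flip2-involutive : ∀ k → flip2 (flip2 k) ≡ k
flip2-involutive zero       = refl
flip2-involutive (suc zero) = refl

same-or-flip : ∀ i j → j ≡ i ⊎ j ≡ flip2 i
same-or-flip zero       zero       = inj₁ refl
same-or-flip zero       (suc zero) = inj₂ refl
same-or-flip (suc zero) zero       = inj₂ refl
same-or-flip (suc zero) (suc zero) = inj₁ refl

module Edges (G : Graph) where
  open Graph G

  _≟ᵇ_ : (δ η : BipEdge G) → Dec (δ ≡ η)
  _≟ᵇ_ = ≡-dec _≟_ _≟_

  -- Counting edges

  cnt : (BipEdge G → Bool) → ℕ
  cnt p = sumFin m λ e → sumFin 2 λ i → ι (p (e , i))

  cnt-point : ∀ {p q} δ → (∀ η → η ≢ δ → p η ≡ q η) → q δ ≡ false →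
    cnt p ≡ ι (p δ) + cnt q
  cnt-point {p} {q} (e , i) off qδ = sumFin-point m e
    (λ f f≢e → sumFin-cong 2 λ j → cong ι (off (f , j) (f≢e ∘ cong proj₁)))
    (sumFin-point 2 i (λ j j≢i → cong ι (off (e , j) (j≢i ∘ cong proj₂)))
      (trans (sym (+-identityʳ _)) (cong (λ b → ι (p (e , i)) + ι b) (sym qδ))))

  infixl 6 _∖_ _⊕_
  _∖_ _⊕_ : Sub G → BipEdge G → Sub G
  (p ∖ δ) η = if ⌊ η ≟ᵇ δ ⌋ then false else p η
  (p ⊕ δ) η = if ⌊ η ≟ᵇ δ ⌋ then true else p η

  ∖-at : ∀ p δ → (p ∖ δ) δ ≡ false
  ∖-at p δ with δ ≟ᵇ δ
  ... | yes _ = refl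
  ... | no δ≢δ = ⊥-elim (δ≢δ refl)

  ∖-off : ∀ p δ η → η ≢ δ → (p ∖ δ) η ≡ p η
  ∖-off p δ η η≢δ with η ≟ᵇ δ
  ... | yes η≡δ = ⊥-elim (η≢δ η≡δ)
  ... | no _ = refl

  ∖-in : ∀ p δ η → (p ∖ δ) η ≡ true → p η ≡ true × η ≢ δ
  ∖-in p δ η h with η ≟ᵇ δ
  ... | no η≢δ = h , η≢δ

  ⊕-at : ∀ p δ → (p ⊕ δ) δ ≡ true
  ⊕-at p δ with δ ≟ᵇ δ
  ... | yes _ = refl
  ... | no δ≢δ = ⊥-elim (δ≢δ refl)

  ⊕-off : ∀ p δ η → η ≢ δ → (p ⊕ δ) η ≡ p η
  ⊕-off p δ η η≢δ with η ≟ᵇ δ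
  ... | yes η≡δ = ⊥-elim (η≢δ η≡δ)
  ... | no _ = refl

  cnt-∖ : ∀ p δ → p δ ≡ true → cnt p ≡ suc (cnt (p ∖ δ))
  cnt-∖ p δ pδ = trans (cnt-point {p} δ (λ η → sym ∘ ∖-off p δ η) (∖-at p δ))
                       (cong (λ b → ι b + cnt (p ∖ δ)) pδ)

  cnt-pos : ∀ p → 0 < cnt p → Σ (BipEdge G) λ δ → p δ ≡ true
  cnt-pos p pos with e , pos₂ ← sumFin-pos m _ pos
    with i , pos₁ ← sumFin-pos 2 (λ i → ι (p (e , i))) pos₂
    with p (e , i) in eq | pos₁
  ... | true | _ = (e , i) , eq

  -- `F` gives every edge of `p` a partner in `q`. Injectivity keeps the partners of the remaining
  -- edges away from `δ'`, so pairs can be removed one at a time.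
  cnt-≤ : ∀ {p q} (F : BipEdge G → BipEdge G → Set) →
    (∀ δ → p δ ≡ true → Σ (BipEdge G) λ δ' → F δ δ' × q δ' ≡ true) →
    (∀ {δ η δ'} → F δ δ' → F η δ' → δ ≡ η) → cnt p ≤ cnt q
  cnt-≤ {p} F total inj = go (cnt p) p _ total refl
    where
    go : ∀ k p q → (∀ δ → p δ ≡ true → Σ (BipEdge G) λ δ' → F δ δ' × q δ' ≡ true) →
      cnt p ≡ k → cnt p ≤ cnt q
    go zero    p q total eq = ≤-trans (≤-reflexive eq) z≤n
    go (suc k) p q total eq
      with δ , pδ ← cnt-pos p (subst (0 <_) (sym eq) (s≤s z≤n))
      with δ' , Fδ , qδ' ← total δ pδ
      rewrite cnt-∖ p δ pδ | cnt-∖ q δ' qδ' =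
      s≤s (go k (p ∖ δ) (q ∖ δ') total' (suc-injective eq))
      where
      total' : ∀ η → (p ∖ δ) η ≡ true → Σ (BipEdge G) λ η' → F η η' × (q ∖ δ') η' ≡ true
      total' η h with pη , η≢δ ← ∖-in p δ η h with η' , Fη , qη' ← total η pη =
        η' , Fη , trans (∖-off q δ' η' λ { refl → η≢δ (inj Fη Fδ) }) qη'

  -- Double counting: once the sums are exchanged, an edge contributes only at its own violet
  -- endpoint.
  degV-filter : ∀ T (a : Fin n → Bool) →
    sumFin n (λ u → if a u then degV G T u else 0) ≡ cnt (λ η → T η ∧ a (vend G η))
  degV-filter T a = begin
    sumFin n (λ u → if a u then degV G T u else 0)
      ≡⟨ sumFin-cong n (λ u → trans (sumFin-if m (a u) _)
                                    (sumFin-cong m λ e → sumFin-if 2 (a u)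
                                       (λ i → ι (T (e , i) ∧ ⌊ vend G (e , i) ≟ u ⌋)))) ⟩
    sumFin n (λ u → sumFin m λ e → sumFin 2 λ i → w u (e , i))
      ≡⟨ sumFin-comm n m _ ⟩
    sumFin m (λ e → sumFin n λ u → sumFin 2 λ i → w u (e , i))
      ≡⟨ sumFin-cong m (λ e → sumFin-comm n 2 λ u i → w u (e , i)) ⟩
    sumFin m (λ e → sumFin 2 λ i → sumFin n λ u → w u (e , i))
      ≡⟨ sumFin-cong m (λ e → sumFin-cong 2 λ i → collapse (e , i)) ⟩
    cnt (λ η → T η ∧ a (vend G η)) ∎
    where
    open ≡-Reasoning
    w : Fin n → BipEdge G → ℕ
    w u η = if a u then ι (T η ∧ ⌊ vend G η ≟ u ⌋) else 0

    off : ∀ η u → u ≢ vend G η → w u η ≡ 0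
    off η u u≢ with vend G η ≟ u | a u | T η
    ... | yes eq | _     | _     = ⊥-elim (u≢ (sym eq))
    ... | no _   | false | _     = refl
    ... | no _   | true  | false = refl
    ... | no _   | true  | true  = refl

    at : ∀ η → w (vend G η) η ≡ ι (T η ∧ a (vend G η)) + 0
    at η with vend G η ≟ vend G η | a (vend G η) | T η
    ... | no ≢ | _     | _     = ⊥-elim (≢ refl)
    ... | yes _ | false | false = refl
    ... | yes _ | false | true  = refl
    ... | yes _ | true  | false = refl
    ... | yes _ | true  | true  = refl

    collapse : ∀ η → sumFin n (λ u → w u η) ≡ ι (T η ∧ a (vend G η))
    collapse η = trans (sumFin-point n (vend G η) (off η) (at η))
                       (trans (cong (ι (T η ∧ a (vend G η)) +_) (sumFin-zero n)) (+-identityʳ _))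

  -- Reachability

  module _ {P : BipEdge G → Set} where
    -- Keeping the end node variable spares later inductions the unification of `endpt G δ (opp c)`
    -- with a given node.
    reach-elim : ∀ {x} (Q : Node G → Set) → Q x →
      (∀ δ c → P δ → Q (endpt G δ c) → Q (endpt G δ (opp c))) →
      ∀ {y} → Reach G P x y → Q y
    reach-elim Q q₀ q₊ here         = q₀
    reach-elim Q q₀ q₊ (step c p r) = q₊ _ c p (reach-elim Q q₀ q₊ r)

    reach-trans : ∀ {x y z} → Reach G P x y → Reach G P y z → Reach G P x z
    reach-trans {x} r = reach-elim (Reach G P x) r λ _ c p → step c p

    reach-edge : ∀ {δ} → P δ → ∀ c d → Reach G P (endpt G δ c) (endpt G δ d)
    reach-edge p violet  violet  = here
    reach-edge p violet  emerald = step violet p here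
    reach-edge p emerald violet  = step emerald p here
    reach-edge p emerald emerald = here

    reach-sym : ∀ {x y} → Reach G P x y → Reach G P y x
    reach-sym {x} = reach-elim (λ y → Reach G P y x) here
      λ _ c p → reach-trans (reach-edge p (opp c) c)

  reach-mono : ∀ {P Q : BipEdge G → Set} → (∀ δ → P δ → Q δ) →
    ∀ {x y} → Reach G P x y → Reach G Q x y
  reach-mono P⊆Q {x} = reach-elim (Reach G _ x) here λ δ c → step c ∘ P⊆Q δ

  -- Repeated crossings of `δ` cancel: after a second one in the same direction the detour in
  -- between is dropped, and one backwards ends where the `δ`-free first part already leads.
  reach-through : ∀ {P Q : BipEdge G → Set} δ → (∀ η → Q η → η ≢ δ → P η) →
    ∀ {x y} → Reach G Q x y →
    Reach G P x y ⊎ Σ Colour λ c → Reach G P x (endpt G δ c) × Reach G P (endpt G δ (opp c)) y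
  reach-through {P} δ Q⊆P {x} = reach-elim
    (λ y → Reach G P x y ⊎
           Σ Colour λ c → Reach G P x (endpt G δ c) × Reach G P (endpt G δ (opp c)) y)
    (inj₁ here) extend
    where
    extend : ∀ η d → _ → _ → _
    extend η d q ih with η ≟ᵇ δ | ih
    ... | no η≢δ  | inj₁ r            = inj₁ (step d (Q⊆P η q η≢δ) r)
    ... | no η≢δ  | inj₂ (c , r , r') = inj₂ (c , r , step d (Q⊆P η q η≢δ) r')
    ... | yes refl | inj₁ r            = inj₂ (d , r , here)
    ... | yes refl | inj₂ (c , r , _) with same-or-opp c d
    ...   | inj₁ refl = inj₂ (c , r , here)
    ...   | inj₂ refl rewrite opp-opp c = inj₁ r

  -- Degrees

  degV-point : ∀ {p q : Sub G} δ → (∀ η → η ≢ δ → p η ≡ q η) → p δ ≡ true → q δ ≡ false →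
    ∀ u → degV G p u ≡ ι ⌊ vend G δ ≟ u ⌋ + degV G q u
  degV-point {p} {q} δ off pδ qδ u = trans
    (cnt-point {λ η → p η ∧ ⌊ vend G η ≟ u ⌋} {λ η → q η ∧ ⌊ vend G η ≟ u ⌋} δ
      (λ η η≢δ → cong (_∧ _) (off η η≢δ)) (cong (_∧ _) qδ))
    (cong (λ b → ι (b ∧ ⌊ vend G δ ≟ u ⌋) + degV G q u) pδ)

  degE-point : ∀ {p q : Sub G} δ → (∀ η → η ≢ δ → p η ≡ q η) → p δ ≡ true → q δ ≡ false →
    ∀ f → degE G p f ≡ ι ⌊ eend G δ ≟ f ⌋ + degE G q f
  degE-point {p} {q} (e , i) off pδ qδ f with e ≟ f
  ... | yes refl = sumFin-point 2 i (λ j j≢i → cong ι (off (e , j) (j≢i ∘ cong proj₂)))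
                     (trans (cong ι pδ) (cong (λ b → 1 + ι b) (sym qδ)))
  ... | no e≢f   = sumFin-cong 2 {λ j → ι (p (f , j))} {λ j → ι (q (f , j))}
                     λ j → cong ι (off (f , j) λ eq → e≢f (sym (cong proj₁ eq)))

  degV-pos : ∀ {p : Sub G} δ → p δ ≡ true → 0 < degV G p (vend G δ)
  degV-pos {p} δ pδ with degV-point {p} {p ∖ δ} δ (λ η → sym ∘ ∖-off p δ η) pδ (∖-at p δ) (vend G δ)
  ... | eq with vend G δ ≟ vend G δ
  ...   | yes _ = subst (0 <_) (sym eq) (s≤s z≤n)
  ...   | no ≢ = ⊥-elim (≢ refl)

  degE-flip : ∀ (p : Sub G) e i → degE G p e ≡ ι (p (e , i)) + ι (p (e , flip2 i))
  degE-flip p e zero       = cong (ι (p (e , zero)) +_) (+-identityʳ _)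
  degE-flip p e (suc zero) = trans (cong (ι (p (e , zero)) +_) (+-identityʳ _))
                                   (+-comm (ι (p (e , zero))) _)

  degE-pos : ∀ {p : Sub G} δ → p δ ≡ true → 0 < degE G p (eend G δ)
  degE-pos {p} (e , i) pδ rewrite degE-flip p e i | pδ = s≤s z≤n

  degE≡2⇒both : ∀ {p : Sub G} {e} → degE G p e ≡ 2 → ∀ i → p (e , i) ≡ true
  degE≡2⇒both {p} {e} d i with p (e , i) | p (e , flip2 i) | trans (sym (degE-flip p e i)) d
  ... | true | _ | _ = refl
  ... | false | true | ()
  ... | false | false | ()

  degE≤2 : ∀ (p : Sub G) e → degE G p e ≤ 2
  degE≤2 p e with p (e , zero) | p (e , suc zero)
  ... | false | false = z≤n
  ... | false | true  = s≤s z≤n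
  ... | true  | false = s≤s z≤n
  ... | true  | true  = ≤-refl

  degE≤1⇒flip-false : ∀ {p : Sub G} {e} → degE G p e ≤ 1 → ∀ i → p (e , i) ≡ true → p (e , flip2 i) ≡ false
  degE≤1⇒flip-false {p} {e} d i pi rewrite degE-flip p e i | pi with p (e , flip2 i) | d
  ... | false | _ = refl
  ... | true | s≤s ()

-- `d₀` stands for the degrees of the forest left after deleting one edge: an edge restored at `x`
-- gives `d`, one added at `x'` gives `d'`. Positivity makes the truncated subtractions exact.
shift-transfer : ∀ {k} {d d₀ d' : Fin k → ℕ} {x x'} → x ≢ x' →
  (∀ u → d u ≡ ι ⌊ x ≟ u ⌋ + d₀ u) → (∀ u → d' u ≡ ι ⌊ x' ≟ u ⌋ + d₀ u) →
  (∀ u → 0 < d u) → 1 ≤ d x ∸ 1 →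
  ∀ u → d' u ≡ suc (shift (λ y → d y ∸ 1) x x' u)
shift-transfer {d = d} {d₀} {d'} {x} {x'} x≢x' dx dx' pos 1≤ u with u ≟ x
... | yes refl with x' ≟ x | dx' x | x ≟ x | dx x
...   | yes eq | _ | _ | _ = ⊥-elim (x≢x' (sym eq))
...   | no _ | _ | no ≢ | _ = ⊥-elim (≢ refl)
...   | no _ | eq' | yes _ | eq with d x | 1≤
...     | suc (suc k) | _ = trans eq' (suc-injective (sym eq))
shift-transfer {d = d} {d₀} {d'} {x} {x'} x≢x' dx dx' pos 1≤ u | no u≢x
  with x ≟ u | dx u
... | yes eq | _ = ⊥-elim (u≢x (sym eq))
... | no _ | eq with u ≟ x' | x' ≟ u | dx' u
...   | yes refl | no ≢ | _ = ⊥-elim (≢ refl)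
...   | no ≢ | yes refl | _ = ⊥-elim (≢ refl)
...   | yes refl | yes _ | eq' = trans eq' (cong suc (trans (sym eq) (sym (suc-pred′ (pos u)))))
  where
  suc-pred′ : ∀ {a} → 0 < a → suc (a ∸ 1) ≡ a
  suc-pred′ (s≤s _) = refl
...   | no _ | no _ | eq' with d u | pos u | eq
...     | suc _ | _ | eq″ = trans eq' (sym eq″)

-- Fundamental cuts and rooted trees.

module Tree (G : Graph) {T : Sub G} (tree : IsSpanningTree G T) where
  open Graph G
  open Edges G

  connected : ∀ x y → Reach G (InT G T) x y
  connected = proj₁ tree

  Side : BipEdge G → Colour → Node G → Set
  Side ε c x = Reach G (InTminus G T ε) (endpt G ε c) x

  side-opp : ∀ {ε} → T ε ≡ true → ∀ c {x} → Side ε c x → ¬ Side ε (opp c) x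
  side-opp {ε} Tε violet  a b = proj₂ tree ε Tε (reach-trans a (reach-sym b))
  side-opp {ε} Tε emerald b a = proj₂ tree ε Tε (reach-trans a (reach-sym b))

  side-unique : ∀ {ε} → T ε ≡ true → ∀ {c d x} → Side ε c x → Side ε d x → c ≡ d
  side-unique Tε {c} {d} a b with same-or-opp c d
  ... | inj₁ refl = refl
  ... | inj₂ refl = ⊥-elim (side-opp Tε c a b)

  -- The last crossing of `ε` on a walk from its violet end decides the component.
  side : ∀ ε x → Σ Colour λ c → Side ε c x
  side ε x = reach-elim (λ x → Σ Colour λ c → Side ε c x) (violet , here) extend
    (connected (endpt G ε violet) x)
    where
    extend : ∀ δ c → T δ ≡ true → _ → _
    extend δ c Tδ (d , r) with δ ≟ᵇ ε
    ... | yes refl = opp c , here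
    ... | no δ≢ε   = d , step c (Tδ , δ≢ε) r

  side? : ∀ {ε} → T ε ≡ true → ∀ c x → Dec (Side ε c x)
  side? {ε} Tε c x with d , r ← side ε x with d ≟ᶜ c
  ... | yes refl = yes r
  ... | no d≢c   = no λ r' → d≢c (side-unique Tε r r')

  side-edge : ∀ {ε c δ} → T δ ≡ true → δ ≢ ε → ∀ d d' →
    Side ε c (endpt G δ d) → Side ε c (endpt G δ d')
  side-edge Tδ δ≢ε d d' r = reach-trans r (reach-edge (Tδ , δ≢ε) d d')

  -- `δ` is the first edge on the tree path from `x` to the root `r`, expressed through the cut of
  -- `δ` instead of through paths.
  Parent : Node G → Node G → BipEdge G → Set
  Parent r x δ = T δ ≡ true × Σ Colour λ c → endpt G δ c ≡ x × Side δ (opp c) r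

  -- Along a walk from `x` to `r`, the candidate is the edge by which `x` was last left; going back
  -- along it returns to `x`.
  parent : ∀ r x → r ≡ x ⊎ Σ (BipEdge G) (Parent r x)
  parent r x = reach-elim (λ y → y ≡ x ⊎ Σ (BipEdge G) (Parent y x)) (inj₁ refl) extend
    (connected x r)
    where
    extend : ∀ η d → T η ≡ true → _ → _
    extend η d Tη (inj₁ eq) = inj₂ (η , Tη , d , eq , here)
    extend η d Tη (inj₂ (δ , Tδ , c , eq , r)) with η ≟ᵇ δ
    ... | no η≢δ = inj₂ (δ , Tδ , c , eq , step d (Tη , η≢δ) r)
    ... | yes refl with same-or-opp c d
    ...   | inj₁ refl = inj₂ (δ , Tδ , c , eq , here)
    ...   | inj₂ refl rewrite opp-opp c = inj₁ eq

  -- Two parent edges δ ≠ δ' would close a cycle through x and r: the path from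
  -- the far end of δ to r avoids δ' too.
  parent-unique : ∀ {r x δ δ'} → Parent r x δ → Parent r x δ' → δ ≡ δ'
  parent-unique {r} {x} {δ} {δ'} (Tδ , c , eq , p) (Tδ' , c' , eq' , p') with δ ≟ᵇ δ'
  ... | yes δ≡δ' = δ≡δ'
  ... | no δ≢δ' = ⊥-elim (side-opp Tδ' c' (reach-trans
          (subst (Side δ' c') (trans eq' (sym eq)) here)
          (reach-trans (reach-edge (Tδ , δ≢δ') c (opp c)) (proj₂ avoids))) p')
    where
    avoids : Side δ (opp c) r × Reach G (InTminus G T δ') (endpt G δ (opp c)) r
    avoids = reach-elim
      (λ z → Side δ (opp c) z × Reach G (InTminus G T δ') (endpt G δ (opp c)) z)
      (here , here)
      (λ { η d (Tη , η≢δ) (s , s') → step d (Tη , η≢δ) s , (case η ≟ᵇ δ' of λ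
        { (no η≢δ') → step d (Tη , η≢δ') s'
        ; (yes refl) → ⊥-elim (side-opp Tδ c
            (subst (Side δ c) (trans eq (sym eq')) here) (side-edge Tη η≢δ d c' s)) }) })
      p

  -- With `parent`, `parent-unique` and `parent-child`, tree edges correspond to the nodes other
  -- than `r`, so two trees can be compared node by node.
  child : ∀ r δ → T δ ≡ true → Σ (Node G) λ x → Parent r x δ
  child r δ Tδ with side δ r
  ... | c , s = endpt G δ (opp c) , Tδ , opp c , refl ,
                subst (λ d → Side δ d r) (sym (opp-opp c)) s

  parent-child : ∀ {r x y δ} → Parent r x δ → Parent r y δ → x ≡ y
  parent-child {δ = δ} (Tδ , c , refl , p) (_ , d , refl , q) =
    cong (endpt G δ) (opp-injective (side-unique Tδ p q))
    where
    opp-injective : ∀ {c d} → opp c ≡ opp d → c ≡ d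
    opp-injective {c} {d} eq = trans (sym (opp-opp c)) (trans (cong opp eq) (opp-opp d))

  -- The emerald node serves as a root different from `u`, so that `u` has a parent edge.
  degV>0 : Fin m → ∀ u → 0 < degV G T u
  degV>0 e u with parent (inj₂ e) (inj₁ u)
  ... | inj₂ (δ , Tδ , violet , refl , _) = degV-pos {T} δ Tδ

  degE>0 : ∀ e → 0 < degE G T e
  degE>0 e with parent (inj₁ (ends e zero)) (inj₂ e)
  ... | inj₂ (δ , Tδ , emerald , refl , _) = degE-pos {T} δ Tδ

  -- Exchanging a tree edge for a crossing non-edge.

  module Exchange {ε δ} (Tε : T ε ≡ true) (Tδ : T δ ≡ false)
    (δ-emerald : Side ε violet (endpt G δ emerald))
    (δ-violet : Side ε emerald (endpt G δ violet)) where

    T' : Sub G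
    T' = T ∖ ε ⊕ δ

    δ≢ε : δ ≢ ε
    δ≢ε refl = case trans (sym Tδ) Tε of λ ()

    T∖ε-δ : (T ∖ ε) δ ≡ false
    T∖ε-δ = trans (∖-off T ε δ δ≢ε) Tδ

    δ-side : ∀ c → Side ε (opp c) (endpt G δ c)
    δ-side violet  = δ-violet
    δ-side emerald = δ-emerald

    T'⊇ : ∀ η → InTminus G T ε η → InT G T' η
    T'⊇ η (Tη , η≢ε) with η ≟ᵇ δ
    ... | yes _ = refl
    ... | no _ = trans (∖-off T ε η η≢ε) Tη

    T'⊆ : ∀ η → T' η ≡ true → η ≢ δ → InTminus G T ε η
    T'⊆ η h η≢δ = ∖-in T ε η (trans (sym (⊕-off (T ∖ ε) δ η η≢δ)) h)

    exchange-tree : IsSpanningTree G T'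
    exchange-tree = (λ x y → reach-trans (reach-sym (from-ε x)) (from-ε y)) , acyclic
      where
      from-ε : ∀ x → Reach G (InT G T') (endpt G ε violet) x
      from-ε x with side ε x
      ... | violet  , r = reach-mono T'⊇ r
      ... | emerald , r = reach-trans (reach-mono T'⊇ δ-emerald) (reach-trans
              (reach-edge (⊕-at (T ∖ ε) δ) emerald violet)
              (reach-trans (reach-sym (reach-mono T'⊇ δ-violet)) (reach-mono T'⊇ r)))

      -- A cycle through `η` that avoids `δ` would already lie in `T`; one that uses `δ` would join
      -- the ends of `δ` within T - ε, across the cut.
      acyclic : ∀ η → T' η ≡ true → ¬ Reach G (InTminus G T' η) (endpt G η violet) (endpt G η emerald)
      acyclic η T'η r with η ≟ᵇ δ in eq
      ... | yes refl = side-opp Tε violet δ-emerald (reach-trans δ-violet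
              (reach-mono (λ { θ (T'θ , θ≢δ) → T'⊆ θ T'θ θ≢δ }) r))
      ... | no η≢δ with Tη , η≢ε ← ∖-in T ε η T'η
        with reach-through {P = λ θ → InTminus G T ε θ × θ ≢ η} δ
               (λ { θ (T'θ , θ≢η) θ≢δ → T'⊆ θ T'θ θ≢δ , θ≢η }) r
      ...   | inj₁ q = proj₂ tree η Tη (reach-mono (λ { θ ((Tθ , _) , θ≢η) → Tθ , θ≢η }) q)
      ...   | inj₂ (c , p , q) = side-opp Tε (opp c) (reach-trans (δ-side c) (reach-trans
                (reach-sym (reach-mono (λ _ → proj₁) p))
                (reach-trans (reach-edge (Tη , η≢ε) violet emerald)
                  (reach-sym (reach-mono (λ _ → proj₁) q))))) (δ-side (opp c))

    hypertreeV : vend G ε ≢ vend G δ → 1 ≤ fV G T (vend G ε) →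
      IsHypertreeV G (shift (fV G T) (vend G ε) (vend G δ))
    hypertreeV ≢ pos = T' , exchange-tree , shift-transfer ≢
      (degV-point ε (λ η → sym ∘ ∖-off T ε η) Tε (∖-at T ε))
      (degV-point δ (⊕-off (T ∖ ε) δ) (⊕-at (T ∖ ε) δ) T∖ε-δ)
      (degV>0 (eend G ε)) pos

    hypertreeE : eend G ε ≢ eend G δ → 1 ≤ fE G T (eend G ε) →
      IsHypertreeE G (shift (fE G T) (eend G ε) (eend G δ))
    hypertreeE ≢ pos = T' , exchange-tree , shift-transfer ≢
      (degE-point ε (λ η → sym ∘ ∖-off T ε η) Tε (∖-at T ε))
      (degE-point δ (⊕-off (T ∖ ε) δ) (⊕-at (T ∖ ε) δ) T∖ε-δ)
      degE>0 pos

-- Degree counts behind a cut.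

module Crossing (G : Graph) {T : Sub G} (tree : IsSpanningTree G T) where
  open Graph G
  open Edges G
  open Tree G tree

  -- Root both trees at the emerald end of ε, outside the violet side A of ε.  Every T-edge with
  -- violet end in A is the T-parent edge of a node of A; the T'-parent edge of that node has
  -- violet end in A as well.
  cnt-side-≤ : ∀ {T' ε} (Tε : T ε ≡ true) → IsSpanningTree G T' →
    (∀ e i → Side ε violet (inj₂ e) → Side ε violet (inj₁ (ends e i))) →
    let a = λ u → ⌊ side? Tε violet (inj₁ u) ⌋ in
    cnt (λ η → T η ∧ a (vend G η)) ≤ cnt (λ η → T' η ∧ a (vend G η))
  cnt-side-≤ {T'} {ε} Tε tree' closed = cnt-≤ F total
    λ { (x , p , p') (y , q , q') → case T'.parent-child p' q' of λ { refl → parent-unique p q } }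
    where
    r = endpt G ε emerald
    a = λ u → ⌊ side? Tε violet (inj₁ u) ⌋
    module T' = Tree G tree'

    F : BipEdge G → BipEdge G → Set
    F δ δ' = Σ (Node G) λ x → Parent r x δ × T'.Parent r x δ'

    a-true : ∀ {u} → Side ε violet (inj₁ u) → a u ≡ true
    a-true {u} s with side? Tε violet (inj₁ u)
    ... | yes _ = refl
    ... | no ¬s = ⊥-elim (¬s s)

    true-a : ∀ δ → T δ ∧ a (vend G δ) ≡ true → T δ ≡ true × Side ε violet (endpt G δ violet)
    true-a δ h with T δ | side? Tε violet (inj₁ (vend G δ)) | h
    ... | true | yes s | _ = refl , s

    child-side : ∀ {δ x} → Side ε violet (endpt G δ violet) → Parent r x δ → Side ε violet x
    child-side {δ} s p@(Tδ , c , refl , _) with δ ≟ᵇ ε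
    ... | no δ≢ε = side-edge Tδ δ≢ε violet c s
    ... | yes refl = subst (Side ε violet) (parent-child (Tε , violet , refl , here) p) here

    total : ∀ δ → T δ ∧ a (vend G δ) ≡ true →
      Σ (BipEdge G) λ δ' → F δ δ' × T' δ' ∧ a (vend G δ') ≡ true
    total δ h with Tδ , s ← true-a δ h with x , p ← child r δ Tδ
      with child-side s p | T'.parent r x
    ... | sx | inj₁ refl = ⊥-elim (side-opp Tε violet sx here)
    ... | sx | inj₂ (δ' , p'@(T'δ' , violet , refl , _)) =
            δ' , (x , p , p') , cong₂ _∧_ T'δ' (a-true sx)
    -- The T'-parent edge of an emerald node of A may lie outside `T`; `closed` keeps its violet end
    -- in A.
    ... | sx | inj₂ (δ' , p'@(T'δ' , emerald , refl , _)) =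
            δ' , (x , p , p') , cong₂ _∧_ T'δ' (a-true (closed _ (proj₂ δ') sx))

  -- Without such a non-edge, emerald nodes of the violet side have all their neighbours there, and
  -- `cnt-side-≤` applies to T'. But T' has a smaller degree at `vend G ε`, and the only increase is
  -- at `v'`, on the other side.
  crossing-nonedge : ∀ {ε v'} → T ε ≡ true → Side ε emerald (inj₁ v') → 1 ≤ fV G T (vend G ε) →
    IsHypertreeV G (shift (fV G T) (vend G ε) v') →
    Σ (BipEdge G) λ δ → T δ ≡ false × Side ε violet (endpt G δ emerald) ×
                        Side ε emerald (endpt G δ violet)
  crossing-nonedge {ε} {v'} Tε side-v' pos (T' , tree' , deg)
    with any? (λ e → any? (λ i → (T (e , i) Bool.≟ false) ×-dec
           side? Tε violet (inj₂ e) ×-dec side? Tε emerald (inj₁ (ends e i))))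
  ... | yes (e , i , h) = (e , i) , h
  ... | no none = ⊥-elim (<-irrefl refl (≤-trans fewer (cnt-side-≤ Tε tree' closed)))
    where
    v = vend G ε
    a = λ u → ⌊ side? Tε violet (inj₁ u) ⌋

    closed : ∀ e i → Side ε violet (inj₂ e) → Side ε violet (inj₁ (ends e i))
    closed e i s with side ε (inj₁ (ends e i)) | (e , i) ≟ᵇ ε | T (e , i) in eq
    ... | violet  , s' | _ | _ = s'
    ... | emerald , s' | _ | false = ⊥-elim (none (e , i , eq , s , s'))
    ... | emerald , s' | yes refl | true = here
    ... | emerald , s' | no ≢ε | true = side-edge eq ≢ε emerald violet s

    suc-fV : ∀ u → suc (fV G T u) ≡ degV G T u
    suc-fV u with degV G T u | degV>0 (eend G ε) u
    ... | suc _ | _ = refl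

    deg-v : degV G T' v < degV G T v
    deg-v with deg v
    ... | eq with v ≟ v
    ...   | no ≢ = ⊥-elim (≢ refl)
    ...   | yes _ = subst (λ d → suc (degV G T' v) ≤ d) (suc-fV v)
              (s≤s (≤-trans (≤-reflexive eq) (≤-reflexive (suc-pred pos))))
      where
      suc-pred : ∀ {k} → 1 ≤ k → suc (k ∸ 1) ≡ k
      suc-pred (s≤s _) = refl

    deg-≤ : ∀ u → Side ε violet (inj₁ u) → degV G T' u ≤ degV G T u
    deg-≤ u s with u ≟ v
    ... | yes refl = <⇒≤ deg-v
    ... | no u≢v with deg u
    ...   | eq with u ≟ v
    ...     | yes u≡v = ⊥-elim (u≢v u≡v)
    ...     | no _ with u ≟ v'
    ...       | yes refl = ⊥-elim (side-opp Tε violet s side-v')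
    ...       | no _ = ≤-reflexive (trans eq (suc-fV u))

    weight-≤ : ∀ u → (if a u then degV G T' u else 0) ≤ (if a u then degV G T u else 0)
    weight-≤ u with side? Tε violet (inj₁ u)
    ... | yes s = deg-≤ u s
    ... | no _ = z≤n

    weight-v : (if a v then degV G T' v else 0) < (if a v then degV G T v else 0)
    weight-v with side? Tε violet (inj₁ v)
    ... | yes s = deg-v
    ... | no ¬s = ⊥-elim (¬s here)

    fewer : cnt (λ η → T' η ∧ a (vend G η)) < cnt (λ η → T η ∧ a (vend G η))
    fewer rewrite sym (degV-filter T' a) | sym (degV-filter T a) =
      sumFin-mono-< n weight-≤ v weight-v

-- The tour and the two sides of a tree edge.

module Tour (G : Graph) (R : Ribbon G) (base : State G) {T : Sub G}
  (tree : IsSpanningTree G T) where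
  open Graph G
  open Ribbon R
  open Edges G
  open Tree G tree

  _≟ˢ_ : (s s' : State G) → Dec (s ≡ s')
  _≟ˢ_ = ≡-dec _≟ᵇ_ _≟ᶜ_

  node : State G → Node G
  node (δ , c) = endpt G δ c

  τ : ℕ → State G
  τ t = iter (tourStep G R T) t base

  node-rot : ∀ s → node (rot G R s) ≡ node s
  node-rot (δ , violet)  = cong inj₁ (rotV-node δ)
  node-rot (δ , emerald) = refl

  τ-edge : ∀ {t δ c} → T δ ≡ true → τ t ≡ (δ , c) → τ (suc t) ≡ rot G R (δ , opp c)
  τ-edge {t} Tδ eq rewrite eq | Tδ = refl

  τ-nonedge : ∀ {t δ c} → T δ ≡ false → τ t ≡ (δ , c) → τ (suc t) ≡ rot G R (δ , c)
  τ-nonedge {t} Tδ eq rewrite eq | Tδ = refl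

  node-edge : ∀ {t δ c} → T δ ≡ true → τ t ≡ (δ , c) → node (τ (suc t)) ≡ endpt G δ (opp c)
  node-edge {t} {δ} {c} Tδ eq = trans (cong node (τ-edge {t} Tδ eq)) (node-rot (δ , opp c))

  -- Rotation does not move the node and tree edges other than `ε` stay within a side, so only
  -- crossing `ε` from its `c`-end leaves.
  stay : ∀ {ε c t} → Side ε c (node (τ t)) → τ t ≢ (ε , c) → Side ε c (node (τ (suc t)))
  stay {ε} {c} {t} s ≢ with τ t in eq
  ... | δ , d with T δ in Tδ
  ...   | false = subst (Side ε c) (sym (node-rot (δ , d))) s
  ...   | true with δ ≟ᵇ ε
  ...     | no δ≢ε = subst (Side ε c) (sym (node-rot (δ , opp d))) (side-edge Tδ δ≢ε d (opp d) s)
  ...     | yes refl with same-or-opp c d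
  ...       | inj₁ refl = ⊥-elim (≢ refl)
  ...       | inj₂ refl = subst (Side ε c) (sym (node-rot (δ , opp (opp c))))
                            (subst (λ e → Side ε c (endpt G ε e)) (sym (opp-opp c)) here)

  -- The second case gives the first departure: the tour is about to cross at time `j` and is across
  -- at `suc j`, hence `j < k`.
  exit : ∀ {ε c a} k → Side ε c (node (τ a)) →
    (∀ j → a ≤ j → j ≤ k → Side ε c (node (τ j))) ⊎
    Σ ℕ λ j → a ≤ j × j < k × τ j ≡ (ε , c) × (∀ i → a ≤ i → i ≤ j → Side ε c (node (τ i)))
  exit {a = zero}  zero s = inj₁ λ { zero _ _ → s }
  exit {a = suc a} zero s = inj₁ λ { zero () _ }
  exit {ε} {c} {a} (suc k) s with exit {ε} {c} {a} k s
  ... | inj₂ (j , a≤j , j<k , eq , all) = inj₂ (j , a≤j , ≤-trans j<k (n≤1+n k) , eq , all)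
  ... | inj₁ all with a ≤? k
  -- Here a ≤ j ≤ k + 1 with a > k, which forces j = a.
  ...   | no a≰k = inj₁ λ j a≤j j≤ → subst (λ j → Side ε c (node (τ j)))
                     (≤-antisym a≤j (≤-trans j≤ (≰⇒> a≰k))) s
  ...   | yes a≤k with τ k ≟ˢ (ε , c)
  ...     | yes eq = inj₂ (k , a≤k , ≤-refl , eq , all)
  ...     | no ≢ = inj₁ λ j a≤j j≤ → case m≤n⇒m<n∨m≡n j≤ of λ
              { (inj₁ (s≤s j≤k)) → all j a≤j j≤k
              ; (inj₂ refl) → stay {t = k} (all k a≤k ≤-refl) ≢ }

  exits : ∀ {ε c a k} → T ε ≡ true → Side ε c (node (τ a)) → a ≤ k →
    Side ε (opp c) (node (τ k)) →
    Σ ℕ λ j → a ≤ j × j < k × τ j ≡ (ε , c) × (∀ i → a ≤ i → i ≤ j → Side ε c (node (τ i)))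
  exits {c = c} {k = k} Tε s a≤k s' with exit k s
  ... | inj₁ all = ⊥-elim (side-opp Tε c (all k a≤k ≤-refl) s')
  ... | inj₂ out = out

  -- If the tour enters the violet side of ε at j and is back at s, then in between it visits
  -- all states there: the visited ones are closed under crossing tree edges (the crossings of
  -- each such edge balance, since the excursion starts and ends at the violet end of ε),
  -- hence under rotation.
  excursion : ∀ {ε j s} → T ε ≡ true → τ j ≡ (ε , emerald) → j < s →
    Side ε emerald (node (τ s)) → ∀ s' → Side ε violet (node s') →
    Σ ℕ λ t → t ≤ s × τ t ≡ s'
  excursion {ε} {j} {s} Tε τj j<s back s' side-s'
    with k , j<k , k<s , τk , inside ← exits {a = suc j} {s} Tε
           (subst (Side ε violet) (sym (node-edge {j} Tε τj)) here) j<s back =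
    let t , _ , t≤k , eq = all-visited side-s' s' refl in t , ≤-trans t≤k (<⇒≤ k<s) , eq
    where
    Visited : State G → Set
    Visited s = Σ ℕ λ t → suc j ≤ t × t ≤ k × τ t ≡ s

    next : ∀ {t s} → τ t ≡ s → proj₁ s ≢ ε → t ≤ k → suc t ≤ k
    next eq ≢ε t≤k = ≤∧≢⇒< t≤k λ { refl → ≢ε (cong proj₁ (trans (sym eq) τk)) }

    cross : ∀ {η c} → T η ≡ true → η ≢ ε → Visited (η , c) → Visited (η , opp c)
    cross {η} {c} Tη η≢ε (t , j<t , t≤k , eq)
      with d , side-v ← side η (endpt G ε violet) with same-or-opp c d
    -- The crossing at `t` leaves the side of `η` where the excursion ends, so a crossing back
    -- follows.
    ... | inj₁ refl
      with i , t<i , i<k , τi , _ ← exits {c = opp c} {suc t} Tη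
             (subst (Side η (opp c)) (sym (node-edge {t} Tη eq)) here)
             (next eq η≢ε t≤k)
             (subst (λ d → Side η d (node (τ k))) (sym (opp-opp c))
               (subst (Side η c) (sym (cong node τk)) side-v)) =
      i , ≤-trans j<t (<⇒≤ t<i) , <⇒≤ i<k , τi
    -- The excursion starts on the other side of `η`, so a crossing towards the `c`-end precedes
    -- `t`.
    ... | inj₂ refl
      with i , j<i , i<t , τi , _ ← exits {c = opp c} {suc j} Tη
             (subst (Side η (opp c)) (sym (node-edge {j} Tε τj)) side-v)
             j<t
             (subst (λ d → Side η d (node (τ t))) (sym (opp-opp c))
               (subst (Side η c) (sym (cong node eq)) here)) =
      i , j<i , ≤-trans (<⇒≤ i<t) t≤k , τi

    -- Rotating past `ε` at its violet end gives the state that opened the excursion, while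
    -- `(ε , emerald)` does not occur within it.
    reenter : ∀ {t c} → suc j ≤ t → t ≤ k → τ t ≡ (ε , c) → Visited (rot G R (ε , c))
    reenter {c = violet}  _ _ _ = suc j , ≤-refl , j<k , τ-edge {j} Tε τj
    reenter {c = emerald} j<t t≤k eq = ⊥-elim (side-opp Tε violet
      (subst (Side ε violet) (cong node eq) (inside _ j<t t≤k)) here)

    -- For a tree edge `η` the rotated state follows `(η , opp c)`, not `(η , c)`, hence the use of
    -- `cross`.
    rotate : ∀ {s} → Visited s → Visited (rot G R s)
    rotate {η , c} v@(t , j<t , t≤k , eq) with T η in Tη | η ≟ᵇ ε
    ... | false | no η≢ε =
      suc t , ≤-trans j<t (n≤1+n t) , next eq η≢ε t≤k , τ-nonedge {t} Tη eq
    ... | false | yes refl = case trans (sym Tη) Tε of λ ()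
    ... | true | no η≢ε with t' , j<t' , t'≤k , eq' ← cross Tη η≢ε v =
      suc t' , ≤-trans j<t' (n≤1+n t') , next eq' η≢ε t'≤k ,
      trans (τ-edge {t'} Tη eq') (cong (λ d → rot G R (η , d)) (opp-opp c))
    ... | true | yes refl = reenter j<t t≤k eq

    rotate* : ∀ i {δ} → Visited (δ , violet) → Visited (iter rotV i δ , violet)
    rotate* zero    v = v
    rotate* (suc i) v = rotate (rotate* i v)

    around : ∀ {s s'} → node s' ≡ node s → Visited s → Visited s'
    around {δ , violet} {δ' , violet} eq v
      with i , refl ← rotV-cyc δ δ' (Sum.inj₁-injective (sym eq)) = rotate* i v
    around {(e , i) , emerald} {(_ , i') , emerald} refl v with same-or-flip i i'
    ... | inj₁ refl = v
    ... | inj₂ refl = rotate v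

    all-visited : ∀ {x} → Side ε violet x → ∀ s → node s ≡ x → Visited s
    all-visited = reach-elim (λ x → ∀ s → node s ≡ x → Visited s)
      (λ s eq → around {ε , violet} eq (k , j<k , ≤-refl , τk))
      λ { η c (Tη , η≢ε) visited s eq →
          around eq (cross Tη η≢ε (visited (η , c) refl)) }

-- Semi-passive edges and bypasses.

module Jaeger (G : Graph) (R : Ribbon G) (base : State G) (T : Sub G)
  (jaeger : IsVCutJaeger G R T base) where
  open Graph G
  open Ribbon R
  open Edges G

  tree : IsSpanningTree G T
  tree = proj₁ jaeger

  open Tree G tree
  open Crossing G tree
  open Tour G R base tree

  InactiveV : Fin n → Set
  InactiveV = InternallyInactive (λ v₁ v₂ → _<V[_,_]_ G R v₁ T base v₂) (IsHypertreeV G) (fV G T)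

  InactiveE : Fin m → Set
  InactiveE = InternallyInactive (λ e₁ e₂ → _<E[_,_]_ G R e₁ T base e₂) (IsHypertreeE G) (fE G T)

  -- Semi-passivity in terms of the tour: some non-edge leads from the part visited before the
  -- first crossing of ε to an emerald node behind ε.
  record Bypass (ε : BipEdge G) : Set where
    field
      in-tree   : T ε ≡ true
      δ         : BipEdge G
      nonedge   : T δ ≡ false
      δ-emerald : Side ε violet (endpt G δ emerald)
      i         : ℕ
      visit     : τ i ≡ (δ , violet)
      before    : ∀ j → j ≤ i → Side ε emerald (node (τ j))

    δ-violet : Side ε emerald (endpt G δ violet)
    δ-violet = subst (Side ε emerald) (cong node visit) (before i ≤-refl)

    base-side : Side ε emerald (node base)
    base-side = before 0 z≤n

    uncrossed : ∀ j → j ≤ i → τ j ≢ (ε , emerald)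
    uncrossed j j≤i eq = case m≤n⇒m<n∨m≡n j≤i of λ
      { (inj₁ j<i) → side-opp in-tree violet
          (subst (Side ε violet) (sym (node-edge {j} in-tree eq)) here) (before (suc j) j<i)
      ; (inj₂ refl) → case trans (sym visit) eq of λ () }

  -- As `ε` lies in its own cut, the smallest cut edge `δ` is met before `(ε , violet)`. Had the
  -- tour been on the violet side before that, it could have come back only through `(ε , violet)`.
  semiPassive⇒bypass : ∀ {ε} → SemiPassive G R T base ε → Bypass ε
  semiPassive⇒bypass (Tε , δ , inj₁ (r , _) , _ , opposite) = ⊥-elim (opposite violet violet r refl)
  semiPassive⇒bypass {ε} (Tε , δ , inj₂ (δ-e , δ-v) , smallest , _) = record
    { in-tree = Tε ; δ = δ ; δ-emerald = δ-e ; i = i ; visit = visit ; before = before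
    ; nonedge = Bool.¬-not λ Tδ → side-opp Tε violet (side-edge Tδ δ≢ε emerald violet δ-e) δ-v }
    where
    δ≢ε : δ ≢ ε
    δ≢ε refl = side-opp Tε violet here δ-v

    first = smallest ε (inj₁ (here , here)) (δ≢ε ∘ sym)
    i = proj₁ first
    visit = proj₁ (proj₂ first)
    unvisited = proj₂ (proj₂ first)

    side-i : Side ε emerald (node (τ i))
    side-i = subst (Side ε emerald) (sym (cong node visit)) δ-v

    no-return : ∀ {a} → a ≤ i → ¬ Side ε violet (node (τ a))
    no-return {a} a≤i s with j , _ , j<i , eq , _ ← exits {a = a} {i} Tε s a≤i side-i =
      unvisited j (<⇒≤ j<i) eq

    before : ∀ j → j ≤ i → Side ε emerald (node (τ j))
    before j j≤i with side ε (node (τ j))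
    ... | emerald , s = s
    ... | violet , s = ⊥-elim (no-return j≤i s)

  -- The smallest cut edge is the first one met at a violet node whose emerald end lies behind `ε`;
  -- it need not be the given `δ`. Cut edges with violet end behind `ε` are not met from there up to
  -- time `i`.
  bypass⇒semiPassive : ∀ {ε} → Bypass ε → SemiPassive G R T base ε
  bypass⇒semiPassive {ε} bypass = go (least crossing? i)
    where
    open Bypass bypass

    Crossing : ℕ → Set
    Crossing j = proj₂ (τ j) ≡ violet × Side ε violet (endpt G (proj₁ (τ j)) emerald)

    crossing? : ∀ j → Dec (Crossing j)
    crossing? j = (proj₂ (τ j) ≟ᶜ violet) ×-dec side? in-tree violet _

    go : _ → SemiPassive G R T base ε
    go (inj₂ none) = ⊥-elim (none i ≤-refl
      (cong proj₂ visit , subst (λ s → Side ε violet (endpt G (proj₁ s) emerald)) (sym visit) δ-emerald))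
    go (inj₁ (j , j≤i , crossing , min)) with τ j in τj | crossing | before j j≤i
    ... | η , violet | _ , η-e | η-v = in-tree , η , inj₂ (η-e , η-v) , smallest , opposite
      where
      smallest : ∀ δ' → InCut G R T ε δ' → δ' ≢ η → Precedes G R T base (η , violet) (δ' , violet)
      smallest δ' cut δ'≢η = j , τj , λ k k≤j τk →
        let side-k = subst (Side ε emerald) (cong node τk) (before k (≤-trans k≤j j≤i)) in
        case cut of λ
          { (inj₁ (s , _)) → side-opp in-tree violet s side-k
          ; (inj₂ (s , _)) → case m≤n⇒m<n∨m≡n k≤j of λ
              { (inj₁ k<j) → min k k<j (cong proj₂ τk ,
                  subst (λ s → Side ε violet (endpt G (proj₁ s) emerald)) (sym τk) s)
              ; (inj₂ refl) → δ'≢η (cong proj₁ (trans (sym τk) τj)) } }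

      opposite : ∀ c c' → Side ε c (endpt G η c') → c ≢ c'
      opposite violet  .violet  s refl = side-opp in-tree violet s η-v
      opposite emerald .emerald s refl = side-opp in-tree violet η-e s

  -- In a V-cut tour (δ , violet) is met while (δ , emerald) is still unvisited, so by
  -- excursion it is not met after the part behind ε.
  nonedge⇒bypass : ∀ {ε δ} → T ε ≡ true → Side ε emerald (node base) → T δ ≡ false →
    Side ε violet (endpt G δ emerald) → Side ε emerald (endpt G δ violet) → Bypass ε
  nonedge⇒bypass {ε} {δ} Tε base-side Tδ δ-e δ-v
    with i , visit , unvisited ← proj₂ jaeger δ Tδ
    with exit {ε} {emerald} {0} i base-side
  ... | inj₁ all = record { in-tree = Tε ; nonedge = Tδ ; δ-emerald = δ-e ; i = i
                          ; visit = visit ; before = λ j → all j z≤n }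
  ... | inj₂ (j , _ , j<i , τj , _)
    with t , t≤i , eq ← excursion {s = i} Tε τj j<i
           (subst (Side ε emerald) (sym (cong node visit)) δ-v) (δ , emerald) δ-e =
    ⊥-elim (unvisited t t≤i eq)

  fV>0 : ∀ {ε η} → T ε ≡ true → T η ≡ true → η ≢ ε → vend G η ≡ vend G ε →
    1 ≤ fV G T (vend G ε)
  fV>0 {ε} {η} Tε Tη η≢ε same
    with degV-point {T} {T ∖ ε} ε (λ θ → sym ∘ ∖-off T ε θ) Tε (∖-at T ε) (vend G ε)
  ... | eq with vend G ε ≟ vend G ε
  ...   | no ≢ = ⊥-elim (≢ refl)
  ...   | yes _ rewrite eq =
            subst (λ u → 0 < degV G (T ∖ ε) u) same (degV-pos {T ∖ ε} η (trans (∖-off T ε η η≢ε) Tη))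

  -- Rotation at `e` is the swap, so the sibling edge comes just before; being a tree edge, it was
  -- crossed from its violet end.
  entering : ∀ {j e k} → T (e , flip2 k) ≡ true → τ (suc j) ≡ ((e , k) , emerald) →
    τ j ≡ ((e , flip2 k) , violet)
  entering {j} Te eq with τ j
  ... | (f , l) , c with T (f , l) in Tl | c | eq
  ...   | true  | violet  | refl = cong (λ l → (f , l) , violet) (sym (flip2-involutive l))
  ...   | false | emerald | refl =
            case trans (sym Tl) (trans (cong (λ l → T (f , l)) (sym (flip2-involutive l))) Te) of λ ()

  -- Both ends of a bypassed edge are inactive.

  module _ {e k} (bypass : Bypass (e , k)) where
    open Bypass bypass

    -- The first tree edge from `e` towards the violet end of `δ` is not `(e , k)`, as that end is
    -- on the emerald side.
    sibling-in-tree : T (e , flip2 k) ≡ true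
    sibling-in-tree with parent (endpt G δ violet) (inj₂ e)
    ... | inj₂ ((_ , l) , Tη , emerald , refl , r) with same-or-flip k l
    ...   | inj₁ refl = ⊥-elim (side-opp in-tree violet r δ-violet)
    ...   | inj₂ refl = Tη

    bypass⇒inactiveV : InactiveV (vend G (e , k))
    bypass⇒inactiveV = vend G δ , less , positive , hypertreeV distinct positive
      where
      open Exchange in-tree nonedge δ-emerald δ-violet using (hypertreeV)

      distinct : vend G (e , k) ≢ vend G δ
      distinct eq = side-opp in-tree violet here
        (subst (Side (e , k) emerald) (cong inj₁ (sym eq)) δ-violet)

      less : _<V[_,_]_ G R (vend G δ) T base (vend G (e , k))
      less = δ , refl , λ ε' same → i , visit , λ j j≤i eq → side-opp in-tree violet
        (subst (Side (e , k) violet) (sym (trans (cong node eq) (cong inj₁ same))) here)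
        (before j j≤i)

      positive : 1 ≤ fV G T (vend G (e , k))
      -- The tree path to the emerald end of `δ` stays on the violet side, so its first edge is a
      -- second tree edge at this node.
      positive with parent (endpt G δ emerald) (inj₁ (vend G (e , k)))
      ... | inj₂ (η , Tη , violet , eq , r) =
        fV>0 in-tree Tη (λ { refl → side-opp in-tree violet δ-emerald r }) (Sum.inj₁-injective eq)

    bypass⇒inactiveE : InactiveE e
    bypass⇒inactiveE = eend G δ , (proj₂ δ , less) , positive , hypertreeE distinct positive
      where
      open Exchange in-tree nonedge δ-emerald δ-violet using (hypertreeE)

      distinct : e ≢ eend G δ
      distinct eq = side-opp in-tree violet δ-emerald
        (subst (Side (e , k) emerald) (cong inj₂ eq) here)

      -- Crossing the sibling into `e` would be followed at once by `((e , k) , emerald)`; at time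
      -- `i` itself the current edge is a non-edge.
      sibling-unvisited : ∀ j → j ≤ i → τ j ≢ ((e , flip2 k) , violet)
      sibling-unvisited j j≤i eq = case m≤n⇒m<n∨m≡n j≤i of λ
        { (inj₁ j<i) → uncrossed (suc j) j<i (trans (τ-edge {j} sibling-in-tree eq)
            (cong (λ l → (e , l) , emerald) (flip2-involutive k)))
        ; (inj₂ refl) → case trans (sym nonedge)
            (trans (cong (T ∘ proj₁) (trans (sym visit) eq)) sibling-in-tree) of λ () }

      less : ∀ l → Precedes G R T base (δ , violet) ((e , l) , violet)
      less l with same-or-flip k l
      ... | inj₁ refl = i , visit , λ j j≤i eq → side-opp in-tree violet
              (subst (Side (e , k) violet) (sym (cong node eq)) here) (before j j≤i)
      ... | inj₂ refl = i , visit , sibling-unvisited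

      positive : 1 ≤ fE G T e
      positive rewrite degE-flip T e k | in-tree | sibling-in-tree = ≤-refl

  -- Uniqueness at each node.

  bypass-uniqueV : ∀ {ε ε'} → Bypass ε → Bypass ε' → vend G ε' ≡ vend G ε → ε' ≡ ε
  bypass-uniqueV b b' same = parent-unique
    (Bypass.in-tree b' , violet , cong inj₁ same , Bypass.base-side b')
    (Bypass.in-tree b , violet , refl , Bypass.base-side b)

  at-emerald : ∀ s {e} → node s ≡ inj₂ e → Σ (Fin 2) λ j → s ≡ ((e , j) , emerald)
  at-emerald ((_ , j) , emerald) refl = j , refl

  at-violet : ∀ s {v} → node s ≡ inj₁ v →
    Σ (BipEdge G) λ ε → vend G ε ≡ v × s ≡ (ε , violet)
  at-violet (ε , violet) refl = ε , refl , refl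

  -- If both edges at e were semi-passive, e would be the base node; but then the tour starts
  -- by crossing one of them.
  bypass-uniqueE : ∀ {e k l} → Bypass (e , k) → Bypass (e , l) → l ≡ k
  bypass-uniqueE {e} {k} {l} b b' with same-or-flip k l
  ... | inj₁ l≡k = l≡k
  ... | inj₂ refl with parent (node base) (inj₂ e)
  ...   | inj₂ ((_ , j) , Tη , emerald , refl , r) = ⊥-elim (case same-or-flip k j of λ
            { (inj₁ refl) → side-opp Tη violet r (Bypass.base-side b)
            ; (inj₂ refl) → side-opp Tη violet r (Bypass.base-side b') })
  ...   | inj₁ eq with j , base-eq ← at-emerald base eq = ⊥-elim (case same-or-flip k j of λ
            { (inj₁ refl) → Bypass.uncrossed b 0 z≤n base-eq
            ; (inj₂ refl) → Bypass.uncrossed b' 0 z≤n base-eq })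

  -- From inactive nodes to bypassed edges.

  inactiveV⇒bypass : ∀ v → InactiveV v → Σ (BipEdge G) λ ε → Bypass ε × vend G ε ≡ v
  inactiveV⇒bypass v (v' , (δ , refl , less) , pos , hyper) with parent (node base) (inj₁ v)
  -- Nothing precedes the base edge at a violet base node.
  ... | inj₁ eq with ε , refl , base-eq ← at-violet base eq =
    ⊥-elim (proj₂ (proj₂ (less ε refl)) 0 z≤n base-eq)
  ... | inj₂ (ε , Tε , violet , refl , base-side)
    -- The state right after `(ε , emerald)` is `(rotV ε , violet)`; as it is unvisited up to time
    -- `i`, `ε` has not been crossed before.
    with i , visit , unvisited ← less (rotV ε) (rotV-node ε)
    with exit {ε} {emerald} {0} i base-side
  ...   | inj₂ (j , _ , j<i , τj , _) = ⊥-elim (unvisited (suc j) j<i (τ-edge {j} Tε τj))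
  ...   | inj₁ all
    with η , Tη , η-e , η-v ← crossing-nonedge Tε
           (subst (Side ε emerald) (cong node visit) (all i z≤n ≤-refl)) pos hyper =
    ε , nonedge⇒bypass Tε base-side Tη η-e η-v , refl

  -- The edge chosen at `e` leads away from the base node; if `e` is the base node, it is the one
  -- that is not the base edge.
  edge-above : ∀ e → (∀ j → T (e , j) ≡ true) → Σ (Fin 2) λ k →
    Side (e , k) emerald (node base) × base ≢ ((e , k) , emerald)
  edge-above e Te with parent (node base) (inj₂ e)
  ... | inj₁ eq with j , base-eq ← at-emerald base eq =
    flip2 j , subst (Side (e , flip2 j) emerald) (sym eq) here ,
    λ eq' → flip2-≢ j (cong (proj₂ ∘ proj₁) (trans (sym eq') base-eq))
  ... | inj₂ ((_ , j) , p@(Tη , emerald , refl , r)) = flip2 j , above ,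
    λ base-eq → side-opp Tη violet r (subst (Side (e , j) emerald) (sym (cong node base-eq)) here)
    where
    above : Side (e , flip2 j) emerald (node base)
    above with side (e , flip2 j) (node base)
    ... | emerald , s = s
    ... | violet , s = ⊥-elim (flip2-≢ j (cong proj₂
            (parent-unique (Te (flip2 j) , emerald , refl , s) p)))

  degE-both : ∀ {p : Sub G} {e} k → p (e , k) ≡ true → p (e , flip2 k) ≡ true → degE G p e ≡ 2
  degE-both {p} {e} k pk pl rewrite degE-flip p e k | pk | pl = refl

  fE>0⇒both : ∀ {e} → 1 ≤ fE G T e → ∀ j → T (e , j) ≡ true
  fE>0⇒both {e} pos = degE≡2⇒both {T} (degE-two (degE≤2 T e) pos)
    where
    degE-two : ∀ {d} → d ≤ 2 → 1 ≤ d ∸ 1 → d ≡ 2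
    degE-two {suc (suc zero)} _ _ = refl
    degE-two {suc zero} _ ()
    degE-two {suc (suc (suc _))} (s≤s (s≤s ())) _

  -- If both ends of e' were on one side, no emerald node of T' would link the two sides.
  separated : ∀ {e e' k} → (∀ j → T (e , j) ≡ true) → IsHypertreeE G (shift (fE G T) e e') →
    ∀ c → ¬ (∀ j → Side (e , k) c (inj₁ (ends e' j)))
  separated {e} {e'} {k} Te (T' , tree' , deg) c same =
    side-opp (Te k) violet
      (reach-elim Linked here extend (proj₁ tree' (inj₁ (ends e k)) (inj₁ (ends e (flip2 k)))))
      (reach-edge (Te (flip2 k) , flip2-≢ k ∘ cong proj₂) emerald violet)
    where
    Linked : Node G → Set
    Linked (inj₁ u) = Side (e , k) violet (inj₁ u)
    Linked (inj₂ f) = Σ (Fin 2) λ j → T' (f , j) ≡ true × Side (e , k) violet (inj₁ (ends f j))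

    -- The degree of `e` in T' is 1, so `f` is not `e`. If `f` is `e'`, `same` applies; otherwise
    -- `f` has degree 2 in `T` too, and both its edges avoid `(e , k)`.
    both : ∀ f j → T' (f , j) ≡ true → T' (f , flip2 j) ≡ true →
      Side (e , k) violet (inj₁ (ends f j)) → Side (e , k) violet (inj₁ (ends f (flip2 j)))
    both f j T'j T'l s with trans (sym (degE-both {T'} j T'j T'l)) (deg f)
    ... | eq with f ≟ e
    ...   | yes refl = case trans eq (cong (λ d → suc (d ∸ 1 ∸ 1))
                         (degE-both {T} k (Te k) (Te (flip2 k)))) of λ ()
    ...   | no f≢e with f ≟ e'
    ...     | yes refl with refl ← side-unique (Te k) s (same j) = same (flip2 j)
    ...     | no _ = side-edge (Tf (flip2 j)) (f≢e ∘ cong proj₁) emerald violet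
                       (side-edge (Tf j) (f≢e ∘ cong proj₁) violet emerald s)
      where
      Tf : ∀ j → T (f , j) ≡ true
      Tf = fE>0⇒both (≤-reflexive (suc-injective eq))

    extend : ∀ δ d → T' δ ≡ true → Linked (endpt G δ d) → Linked (endpt G δ (opp d))
    extend (f , j) violet  T'δ s = j , T'δ , s
    extend (f , j) emerald T'δ (l , T'l , s) with same-or-flip l j
    ... | inj₁ refl = s
    ... | inj₂ refl = both f l T'l T'δ s

  tree-edge : ∀ e → Σ (Fin 2) λ l → T (e , l) ≡ true
  tree-edge e with parent (inj₁ (ends e zero)) (inj₂ e)
  ... | inj₂ ((_ , l) , Tl , emerald , refl , _) = l , Tl

  -- The degree of `e'` rises, so `e'` is a leaf of `T` and lies on the side of its tree neighbour.
  -- By `separated` its other neighbour is across the cut, and so its non-edge crosses.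
  inactiveE⇒bypass : ∀ e → InactiveE e → Σ (BipEdge G) λ ε → Bypass ε × eend G ε ≡ e
  inactiveE⇒bypass e (e' , (j , less) , pos , hyper@(T' , _ , deg))
    with Te ← fE>0⇒both pos
    with k , base-side , base≢ ← edge-above e Te
    with l , Tl ← tree-edge e'
    -- After time 0, `((e , k) , emerald)` can only follow a crossing of this sibling from its
    -- violet end.
    with i , visit , unvisited ← less (flip2 k) = (e , k) , bypass , refl
    where
    ε = e , k

    e'≢e : e' ≢ e
    e'≢e refl with i , visit , unvisited ← less j = unvisited i ≤-refl visit

    uncrossed : ∀ t → t ≤ i → τ t ≢ (ε , emerald)
    uncrossed zero    _   eq = base≢ eq
    uncrossed (suc t) t<i eq = unvisited t (<⇒≤ t<i) (entering {t} (Te (flip2 k)) eq)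

    inside : ∀ t → t ≤ i → Side ε emerald (node (τ t))
    inside with exit {ε} {emerald} {0} i base-side
    ... | inj₁ all = λ t → all t z≤n
    ... | inj₂ (t , _ , t<i , eq , _) = ⊥-elim (uncrossed t (<⇒≤ t<i) eq)

    leaf : degE G T e' ≤ 1
    leaf with deg e'
    ... | eq with e' ≟ e
    ...   | yes e'≡e = ⊥-elim (e'≢e e'≡e)
    ...   | no _ with e' ≟ e'
    ...     | no ≢ = ⊥-elim (≢ refl)
    ...     | yes _ = bound (≤-trans (≤-reflexive (sym eq)) (degE≤2 T' e'))
      where
      bound : ∀ {d} → suc (suc (d ∸ 1)) ≤ 2 → d ≤ 1
      bound {zero} _ = z≤n
      bound {suc zero} _ = ≤-refl
      bound {suc (suc _)} (s≤s (s≤s ()))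

    δ = e' , flip2 l

    Tδ : T δ ≡ false
    Tδ = degE≤1⇒flip-false {T} leaf l Tl

    ends-side : ∀ {c} → Side ε c (inj₁ (ends e' l)) → Side ε c (inj₂ e')
    ends-side = side-edge Tl (e'≢e ∘ cong proj₁) violet emerald

    visit-side : Side ε emerald (inj₁ (ends e' j))
    visit-side = subst (Side ε emerald) (cong node visit) (inside i ≤-refl)

    not-same : ∀ {c} → Side ε c (inj₁ (ends e' l)) → ¬ Side ε c (inj₁ (ends e' (flip2 l)))
    not-same {c} s s' = separated Te hyper c λ j' → case same-or-flip l j' of λ
      { (inj₁ refl) → s ; (inj₂ refl) → s' }

    -- The visit at time i is not at the tree edge of e': the next state would be
    -- (δ , emerald), before any visit to (δ , violet).
    j≢l : j ≢ l
    j≢l refl with side ε (inj₁ (ends e' (flip2 l)))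
    ... | emerald , s = not-same visit-side s
    ... | violet , s with t , visit' , unvisited' ← proj₂ jaeger δ Tδ with t ≤? i
    ...   | yes t≤i = side-opp (Te k) violet s
                        (subst (Side ε emerald) (cong node visit') (inside t t≤i))
    ...   | no t≰i = unvisited' (suc i) (≰⇒> t≰i) (τ-edge {i} Tl visit)

    bypass : Bypass ε
    bypass with same-or-flip l j | side ε (inj₁ (ends e' l))
    ... | inj₁ j≡l | _ = ⊥-elim (j≢l j≡l)
    ... | inj₂ refl | emerald , s = ⊥-elim (not-same s visit-side)
    ... | inj₂ refl | violet , s = record
      { in-tree = Te k ; nonedge = Tδ ; δ-emerald = ends-side s ; i = i
      ; visit = visit ; before = inside }

-- Assembly of the matching.

theorem8p2 : (G : Graph) (R : Ribbon G) (base : State G) (T : Sub G) →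
    IsVCutJaeger G R T base →
    let S = SemiPassive G R T base
        InV = InternallyInactive (λ v₁ v₂ → _<V[_,_]_ G R v₁ T base v₂)
                (IsHypertreeV G) (fV G T)
        InE = InternallyInactive (λ e₁ e₂ → _<E[_,_]_ G R e₁ T base e₂)
                (IsHypertreeE G) (fE G T)
    in ((∀ ε → S ε → InV (vend G ε) × InE (eend G ε)) ×
        (∀ v → InV v → Σ (BipEdge G) λ ε → (S ε × vend G ε ≡ v) ×
             (∀ ε' → S ε' → vend G ε' ≡ v → ε' ≡ ε))) ×
        (∀ e → InE e → Σ (BipEdge G) λ ε → (S ε × eend G ε ≡ e) ×
             (∀ ε' → S ε' → eend G ε' ≡ e → ε' ≡ ε))
theorem8p2 G R base T jaeger = (matched , matchV) , matchE
  where
  open Jaeger G R base T jaeger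

  matched : ∀ ε → SemiPassive G R T base ε → InactiveV (vend G ε) × InactiveE (eend G ε)
  matched ε s = bypass⇒inactiveV b , bypass⇒inactiveE b
    where b = semiPassive⇒bypass s

  matchV : ∀ v → InactiveV v → _
  matchV v inactive with ε , b , refl ← inactiveV⇒bypass v inactive =
    ε , (bypass⇒semiPassive b , refl) ,
    λ ε' s → bypass-uniqueV b (semiPassive⇒bypass s)

  matchE : ∀ e → InactiveE e → _
  matchE e inactive with (_ , k) , b , refl ← inactiveE⇒bypass e inactive =
    (e , k) , (bypass⇒semiPassive b , refl) ,
    λ { (_ , l) s refl → cong (e ,_) (bypass-uniqueE b (semiPassive⇒bypass s)) }
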